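{- Let $k\ge0$. Let $B_k(x)=\sum_{n\ge1}b_{n,k}x^n$, where $b_{n,k}$ is the total number, over all Schroeder trees with $n$ leaves, of vertices that are balanced and of rank $k$. Let $B_k^*(x)=\sum_{n\ge1}b^*_{n,k}x^n$, where $b^*_{n,k}$ is the number of Schroeder trees with $n$ leaves whose root is balanced and of rank $k$. Then $$B_k(x)=B_k^*(x)\,\frac{3-x+\sqrt{1-6x+x^2}}{4\sqrt{1-6x+x^2}}.$$
   Context: A Schroeder tree is a finite rooted plane tree (the children of each vertex are linearly ordered) in which every non-leaf vertex has at least two children. A leaf is a vertex with no children; the one-vertex tree is a Schroeder tree with one leaf. Trees are counted up to isomorphism of rooted plane trees. A vertex has rank $k$ if the shortest path from it to a leaf travelling strictly through descendants has length $k$ (number of edges); a leaf has rank $0$. A vertex is balanced if its shortest and longest descending paths to a leaf have the same length. Thus a vertex is balanced of rank $k$ if and only if all descending paths from it to a leaf have length $k$. $\sqrt{1-6x+x^2}$ denotes the formal power series square root with constant term $1$. -}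

module Defs where

open import Data.Empty using (⊥-elim)
open import Data.Fin.Base as Fin using (Fin; toℕ)
open import Data.Fin.Properties using (toℕ-fromℕ; toℕ-inject₁; toℕ<n)
import Data.Integer.Base as ℤ
open import Data.List.Base
  using (List; []; _∷_; [_]; _++_; map; concatMap; length; filter; cartesianProduct)
open import Data.List.Membership.Propositional using (_∈_)
open import Data.List.Membership.Propositional.Properties
  using (∈-map⁺; ∈-map⁻; ∈-++⁺ˡ; ∈-++⁺ʳ; ∈-++⁻; ∈-concat⁺′; ∈-concat⁻′;
         ∈-cartesianProduct⁺; ∈-cartesianProduct⁻)
open import Data.List.NonEmpty.Base as List⁺ using (List⁺; _∷_; _⁺++⁺_; _⁺++_; foldr₁; toList)
open import Data.List.Relation.Binary.Disjoint.Propositional using (Disjoint)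
open import Data.List.Relation.Unary.All as All using (All; []; _∷_)
import Data.List.Relation.Unary.All.Properties as All
open import Data.List.Relation.Unary.AllPairs as AllPairs using ([]; _∷_)
import Data.List.Relation.Unary.AllPairs.Properties as AllPairs
open import Data.List.Relation.Unary.Any using (here; there)
open import Data.List.Relation.Unary.Unique.Propositional using (Unique)
import Data.List.Relation.Unary.Unique.Propositional.Properties as Unique
open import Data.Nat.Base as ℕ using (ℕ; zero; suc; z≤n; s≤s; _⊓_; _⊔_; _∸_)
open import Data.Nat.ListAction using (sum)
import Data.Nat.Properties as ℕ
open import Data.Product.Base using (_×_; _,_; proj₁; proj₂; uncurry; map₁)
open import Data.Rational.Base
  using (ℚ; 0ℚ; 1ℚ; ½; _/_; _+_; _*_; _-_; 1/_; NonZero)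
import Data.Rational.Properties as ℚ
open import Data.Rational.Solver using (module +-*-Solver)
open import Data.Sum.Base using (inj₁; inj₂)
open import Function.Base using (_∘_)
open import Function.Bundles using (_⇔_; mk⇔)
open import Relation.Binary.PropositionalEquality
  using (_≡_; _≢_; refl; sym; trans; cong; cong₂; subst; _≗_; module ≡-Reasoning)
open import Relation.Nullary.Decidable using (Dec; yes; no; _×-dec_)
import Algebra.Properties.Semiring.Sum as Sum
open import Algebra.Bundles using (CommutativeRing)

-- Schroeder trees: a non-leaf vertex has its first two children and then a list of
-- further ones.  Propositional equality is isomorphism of rooted plane trees.

data Tree : Set where
  leaf : Tree
  node : (t u : Tree) (ts : List Tree) → Tree

mutual
  leaves : Tree → ℕ
  leaves leaf          = 1
  leaves (node t u ts) = leaves t ℕ.+ (leaves u ℕ.+ leavesᶠ ts)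

  leavesᶠ : List Tree → ℕ
  leavesᶠ []       = 0
  leavesᶠ (t ∷ ts) = leaves t ℕ.+ leavesᶠ ts

-- The vertices in preorder, each represented by the subtree consisting of
-- it and its descendants (so equal subtrees occur with multiplicity).

mutual
  vertices : Tree → List Tree
  vertices leaf            = [ leaf ]
  vertices t₀@(node t u ts) = t₀ ∷ vertices t ++ vertices u ++ verticesᶠ ts

  verticesᶠ : List Tree → List Tree
  verticesᶠ []       = []
  verticesᶠ (t ∷ ts) = vertices t ++ verticesᶠ ts

-- The lengths of all descending paths from the root to a leaf.

mutual
  descents : Tree → List⁺ ℕ
  descents leaf          = List⁺.[ 0 ]
  descents (node t u ts) = List⁺.map suc (descents t ⁺++⁺ (descents u ⁺++ descentsᶠ ts))

  descentsᶠ : List Tree → List ℕ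
  descentsᶠ []       = []
  descentsᶠ (t ∷ ts) = toList (descents t) ++ descentsᶠ ts

-- Applied to the subtree below a vertex, these describe that vertex.

rank : Tree → ℕ
rank = foldr₁ _⊓_ ∘ descents

height : Tree → ℕ
height = foldr₁ _⊔_ ∘ descents

Balanced : Tree → Set
Balanced t = rank t ≡ height t

BalancedOfRank : ℕ → Tree → Set
BalancedOfRank k t = Balanced t × rank t ≡ k

balancedOfRank? : ∀ k t → Dec (BalancedOfRank k t)
balancedOfRank? k t = (rank t ℕ.≟ height t) ×-dec (rank t ℕ.≟ k)

splits : ℕ → List (ℕ × ℕ)
splits zero    = [ (0 , 0) ]
splits (suc n) = (0 , suc n) ∷ map (map₁ suc) (splits n)

infixr 7 _⊠_

_⊠_ : {A B : Set} → (ℕ → List A) → (ℕ → List B) → ℕ → List (A × B)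
(as ⊠ bs) n = concatMap (λ (i , j) → cartesianProduct (as i) (bs j)) (splits n)

nil : ℕ → List (List Tree)
nil zero    = [ [] ]
nil (suc _) = []

-- Lists of at most m trees drawn from ts, with n leaves in total.

forests : (ℕ → List Tree) → ℕ → ℕ → List (List Tree)
forests ts zero    n = nil n
forests ts (suc m) n = nil n ++ map (uncurry _∷_) ((ts ⊠ forests ts m) n)

single : ℕ → List Tree
single 1 = [ leaf ]
single _ = []

mk : Tree × Tree × List Tree → Tree
mk (t , u , us) = node t u us

-- The leaf, and the nodes all of whose children are in ts.  A list of trees
-- with q leaves in total consists of at most q trees.

grow : (ℕ → List Tree) → ℕ → List Tree
grow ts n = single n ++ map mk ((ts ⊠ ts ⊠ λ q → forests ts q q) n)

-- Trees of height less than h with n leaves.  A tree with n leaves has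
-- height less than n.

treesBelow : ℕ → ℕ → List Tree
treesBelow zero    = λ _ → []
treesBelow (suc h) = grow (treesBelow h)

trees : ℕ → List Tree
trees n = treesBelow n n

-- The enumeration is correct: trees n lists every tree with n leaves
-- exactly once (∈-trees and trees-unique below).

private
  Sound : {A : Set} → (A → ℕ) → (ℕ → List A) → Set
  Sound size as = ∀ {n x} → x ∈ as n → size x ≡ n

  splits-sum : ∀ n {i j} → (i , j) ∈ splits n → i ℕ.+ j ≡ n
  splits-sum zero    (here refl) = refl
  splits-sum (suc n) (here refl) = refl
  splits-sum (suc n) (there p) with ∈-map⁻ (map₁ suc) p
  ... | _ , q , refl = cong suc (splits-sum n q)

  ∈-splits : ∀ i j → (i , j) ∈ splits (i ℕ.+ j)
  ∈-splits zero    zero    = here refl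
  ∈-splits zero    (suc j) = here refl
  ∈-splits (suc i) j       = there (∈-map⁺ (map₁ suc) (∈-splits i j))

  splits-unique : ∀ n → Unique (splits n)
  splits-unique zero    = [] ∷ []
  splits-unique (suc n) =
    All.map⁺ (All.tabulate λ _ ()) ∷
    Unique.map⁺ (λ { refl → refl }) (splits-unique n)

  pairSize : {A B : Set} → (A → ℕ) → (B → ℕ) → A × B → ℕ
  pairSize f g (x , y) = f x ℕ.+ g y

  module _ {A B : Set} (f : A → ℕ) (g : B → ℕ) {as : ℕ → List A} {bs : ℕ → List B} where

    ⊠-sound : Sound f as → Sound g bs → Sound (pairSize f g) (as ⊠ bs)
    ⊠-sound sa sb {n} {x , y} p with ∈-concat⁻′ (map _ (splits n)) p
    ... | _ , q , r with ∈-map⁻ _ r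
    ... | (i , j) , s , refl with ∈-cartesianProduct⁻ (as i) (bs j) q
    ... | u , v = trans (cong₂ ℕ._+_ (sa u) (sb v)) (splits-sum n s)

    ⊠-complete : ∀ {x y} → x ∈ as (f x) → y ∈ bs (g y) → (x , y) ∈ (as ⊠ bs) (f x ℕ.+ g y)
    ⊠-complete {x} {y} p q =
      ∈-concat⁺′ (∈-cartesianProduct⁺ p q) (∈-map⁺ _ (∈-splits (f x) (g y)))

    ⊠-unique : Sound f as → Sound g bs → (∀ n → Unique (as n)) → (∀ n → Unique (bs n)) →
               ∀ n → Unique ((as ⊠ bs) n)
    ⊠-unique sa sb ua ub n = Unique.concat⁺
      (All.map⁺ (All.tabulate λ {(i , j)} _ → Unique.cartesianProduct⁺ (ua i) (ub j)))
      (AllPairs.map⁺ (AllPairs.map disjoint (splits-unique n)))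
      where
      disjoint : ∀ {s t} → s ≢ t →
                 Disjoint (cartesianProduct (as (proj₁ s)) (bs (proj₂ s)))
                          (cartesianProduct (as (proj₁ t)) (bs (proj₂ t)))
      disjoint {i , j} {i′ , j′} s≢t (p , q)
        with ∈-cartesianProduct⁻ (as i) (bs j) p | ∈-cartesianProduct⁻ (as i′) (bs j′) q
      ... | x , y | x′ , y′ =
        s≢t (cong₂ _,_ (trans (sym (sa x)) (sa x′)) (trans (sym (sb y)) (sb y′)))

  nil-sound : Sound leavesᶠ nil
  nil-sound {zero} (here refl) = refl

  nil-unique : ∀ n → Unique (nil n)
  nil-unique zero    = [] ∷ []
  nil-unique (suc n) = []

  ∈-nil : ∀ {n ts} → ts ∈ nil n → ts ≡ []
  ∈-nil {zero} (here p) = p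

  single-sound : Sound leaves single
  single-sound {1} (here refl) = refl

  single-unique : ∀ n → Unique (single n)
  single-unique 0             = []
  single-unique 1             = [] ∷ []
  single-unique (suc (suc n)) = []

  ∈-single : ∀ {n t} → t ∈ single n → t ≡ leaf
  ∈-single {1} (here p) = p

  module _ {ts : ℕ → List Tree} (st : Sound leaves ts) where

    forests-sound : ∀ m → Sound leavesᶠ (forests ts m)
    forests-sound zero    p = nil-sound p
    forests-sound (suc m) {n} p with ∈-++⁻ (nil n) p
    ... | inj₁ q = nil-sound q
    ... | inj₂ q with ∈-map⁻ (uncurry _∷_) q
    ... | _ , r , refl = ⊠-sound leaves leavesᶠ {ts} {forests ts m} st (forests-sound m) r

    forests-unique : (∀ n → Unique (ts n)) → ∀ m n → Unique (forests ts m n)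
    forests-unique ut zero    n = nil-unique n
    forests-unique ut (suc m) n = Unique.++⁺ (nil-unique n)
      (Unique.map⁺ (λ { refl → refl })
        (⊠-unique leaves leavesᶠ {ts} {forests ts m} st (forests-sound m) ut (forests-unique ut m) n))
      disjoint
      where
      disjoint : Disjoint (nil n) (map (uncurry _∷_) ((ts ⊠ forests ts m) n))
      disjoint (p , q) with ∈-nil {n} p | ∈-map⁻ (uncurry _∷_) q
      ... | refl | _ , _ , ()

  treesBelow-sound : ∀ h → Sound leaves (treesBelow h)
  treesBelow-sound (suc h) {n} p with ∈-++⁻ (single n) p
  ... | inj₁ q = single-sound q
  ... | inj₂ q with ∈-map⁻ _ q
  ... | _ , r , refl =
    ⊠-sound leaves (pairSize leaves leavesᶠ) {treesBelow h} st
      (⊠-sound leaves leavesᶠ {treesBelow h} st (λ {q} → forests-sound st q)) r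
    where st = treesBelow-sound h

  treesBelow-unique : ∀ h n → Unique (treesBelow h n)
  treesBelow-unique zero    n = []
  treesBelow-unique (suc h) n = Unique.++⁺ (single-unique n)
    (Unique.map⁺ (λ { refl → refl })
      (⊠-unique leaves (pairSize leaves leavesᶠ) {ts} st
        (⊠-sound leaves leavesᶠ {ts} st (λ {q} → forests-sound st q)) ut
        (⊠-unique leaves leavesᶠ {ts} st (λ {q} → forests-sound st q)
          ut (λ q → forests-unique st ut q q)) n))
    disjoint
    where
    ts = treesBelow h
    st = treesBelow-sound h
    ut = treesBelow-unique h
    disjoint : Disjoint (single n)
      (map mk ((ts ⊠ ts ⊠ λ q → forests ts q q) n))
    disjoint (p , q) with ∈-single {n} p | ∈-map⁻ _ q
    ... | refl | _ , _ , ()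

  leaves>0 : ∀ t → 0 ℕ.< leaves t
  leaves>0 leaf          = s≤s z≤n
  leaves>0 (node t u ts) = ℕ.≤-trans (leaves>0 t) (ℕ.m≤m+n _ _)

  -- In x + y ≤ suc m with a positive summand, the other one is at most m.

  dropˡ : ∀ {x y m} → 0 ℕ.< x → x ℕ.+ y ℕ.≤ suc m → y ℕ.≤ m
  dropˡ {suc x} _ (s≤s p) = ℕ.≤-trans (ℕ.m≤n+m _ x) p

  dropʳ : ∀ {x y m} → 0 ℕ.< y → x ℕ.+ y ℕ.≤ suc m → x ℕ.≤ m
  dropʳ {x} {y} {m} 0<y p = dropˡ {y} {x} 0<y (subst (ℕ._≤ suc m) (ℕ.+-comm x y) p)

  forests-complete : ∀ {ts : ℕ → List Tree} m us → leavesᶠ us ℕ.≤ m →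
    (∀ t → leaves t ℕ.≤ leavesᶠ us → t ∈ ts (leaves t)) →
    us ∈ forests ts m (leavesᶠ us)
  forests-complete zero    []       _ _ = here refl
  forests-complete (suc m) []       _ _ = here refl
  forests-complete zero    (t ∷ us) p _ with leaves t | leaves>0 t
  forests-complete zero    (t ∷ us) () _ | suc _ | _
  forests-complete {ts} (suc m) (t ∷ us) p c = ∈-++⁺ʳ (nil (leavesᶠ (t ∷ us)))
    (∈-map⁺ (uncurry _∷_)
      (⊠-complete leaves leavesᶠ {ts} {forests ts m} (c t (ℕ.m≤m+n _ _))
        (forests-complete m us (dropˡ (leaves>0 t) p)
          (λ u q → c u (ℕ.≤-trans q (ℕ.m≤n+m _ (leaves t)))))))

  treesBelow-complete : ∀ h t → leaves t ℕ.≤ h → t ∈ treesBelow h (leaves t)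
  treesBelow-complete zero t p = ⊥-elim (ℕ.<⇒≱ (leaves>0 t) p)
  treesBelow-complete (suc h) leaf p = here refl
  treesBelow-complete (suc h) (node t u us) p = ∈-++⁺ʳ (single (leaves (node t u us)))
    (∈-map⁺ _
      (⊠-complete leaves (pairSize leaves leavesᶠ) {treesBelow h} {treesBelow h ⊠ fs} (c t (dropʳ u+us>0 p))
        (⊠-complete leaves leavesᶠ {treesBelow h} {fs} (c u (ℕ.≤-trans (ℕ.m≤m+n _ _) u+us≤h))
          (forests-complete {treesBelow h} _ us ℕ.≤-refl
            (λ v q → c v (ℕ.≤-trans q (ℕ.≤-trans (ℕ.m≤n+m _ (leaves u)) u+us≤h)))))))
    where
    c = treesBelow-complete h
    fs = λ q → forests (treesBelow h) q q
    u+us>0 = ℕ.≤-trans (leaves>0 u) (ℕ.m≤m+n _ (leavesᶠ us))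
    u+us≤h = dropˡ (leaves>0 t) p

∈-trees : ∀ {n t} → t ∈ trees n ⇔ leaves t ≡ n
∈-trees {n} {t} = mk⇔ (treesBelow-sound n) λ { refl → treesBelow-complete _ t ℕ.≤-refl }

trees-unique : ∀ n → Unique (trees n)
trees-unique n = treesBelow-unique n n

b : ℕ → ℕ → ℕ
b n k = sum (map (λ t → length (filter (balancedOfRank? k) (vertices t))) (trees n))

b* : ℕ → ℕ → ℕ
b* n k = length (filter (balancedOfRank? k) (trees n))

-- Formal power series over ℚ, as coefficient sequences; equality is _≗_

PowerSeries : Set
PowerSeries = ℕ → ℚ

open Sum (CommutativeRing.semiring ℚ.+-*-commutativeRing)
  using (sum-syntax; sum⁺-syntax; sum-init-last; sum-cong-≗)

fromℕ : ℕ → ℚ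
fromℕ n = ℤ.+ n / 1

const : ℕ → PowerSeries
const c zero    = fromℕ c
const c (suc _) = 0ℚ

X : PowerSeries
X 1 = 1ℚ
X _ = 0ℚ

infixl 6 _+ˢ_ _-ˢ_
infixl 7 _*ˢ_ _÷ˢ_

_+ˢ_ _-ˢ_ _*ˢ_ : PowerSeries → PowerSeries → PowerSeries
(f +ˢ g) n = f n + g n
(f -ˢ g) n = f n - g n
(f *ˢ g) n = ∑[ i ≤ n ] (f (toℕ i) * g (n ∸ toℕ i))

-- Long division: with q₀ = f₀ / g₀ one has f / g = q₀ + x ((f - q₀ g) / x) / g.

_÷ˢ_ : (f g : PowerSeries) → .{{NonZero (g 0)}} → PowerSeries
(f ÷ˢ g) zero    = f 0 * 1/ g 0
(f ÷ˢ g) (suc n) = ((λ m → f (suc m) - (f 0 * 1/ g 0) * g (suc m)) ÷ˢ g) n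

-- The square root with constant term 1 of a series f with constant term 1.
-- sqrtUpTo f n is the root truncated after xⁿ; the coefficient of xⁿ⁺¹ is
-- then forced, because it enters the square linearly with factor 2.

sqrtUpTo : PowerSeries → ℕ → PowerSeries
sqrtUpTo f zero    = const 1
sqrtUpTo f (suc n) m with m ℕ.≟ suc n
... | yes _ = ½ * (f m - (sqrtUpTo f n *ˢ sqrtUpTo f n) m)
... | no  _ = sqrtUpTo f n m

sqrt : PowerSeries → PowerSeries
sqrt f n = sqrtUpTo f n n

÷ˢ-*ˢ : ∀ f g .{{_ : NonZero (g 0)}} → (f ÷ˢ g) *ˢ g ≗ f
÷ˢ-*ˢ f g zero = begin
  f 0 * 1/ g 0 * g 0 + 0ℚ  ≡⟨ ℚ.+-identityʳ _ ⟩
  f 0 * 1/ g 0 * g 0       ≡⟨ ℚ.*-assoc (f 0) (1/ g 0) (g 0) ⟩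
  f 0 * (1/ g 0 * g 0)     ≡⟨ cong (f 0 *_) (ℚ.*-inverseˡ (g 0)) ⟩
  f 0 * 1ℚ                 ≡⟨ ℚ.*-identityʳ (f 0) ⟩
  f 0                      ∎
  where open ≡-Reasoning
÷ˢ-*ˢ f g (suc n) = trans
  (cong (((f 0 * 1/ g 0) * g (suc n)) +_) (÷ˢ-*ˢ (λ m → f (suc m) - (f 0 * 1/ g 0) * g (suc m)) g n))
  (solve 2 (λ a b → a :+ (b :- a) := b) refl ((f 0 * 1/ g 0) * g (suc n)) (f (suc n)))
  where open +-*-Solver

private
  sqrtUpTo-new : ∀ f n → sqrtUpTo f (suc n) (suc n) ≡
    ½ * (f (suc n) - (sqrtUpTo f n *ˢ sqrtUpTo f n) (suc n))
  sqrtUpTo-new f n with suc n ℕ.≟ suc n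
  ... | yes _ = refl
  ... | no ¬p = ⊥-elim (¬p refl)

  sqrtUpTo-old : ∀ f {m n} → m ≢ suc n → sqrtUpTo f (suc n) m ≡ sqrtUpTo f n m
  sqrtUpTo-old f {m} {n} m≢ with m ℕ.≟ suc n
  ... | yes p = ⊥-elim (m≢ p)
  ... | no  _ = refl

  sqrtUpTo-beyond : ∀ f {m} n → n ℕ.< m → sqrtUpTo f n m ≡ 0ℚ
  sqrtUpTo-beyond f zero    (s≤s _) = refl
  sqrtUpTo-beyond f (suc n) n<m =
    trans (sqrtUpTo-old f (ℕ.>⇒≢ n<m)) (sqrtUpTo-beyond f n (ℕ.<-trans (ℕ.n<1+n n) n<m))

  sqrtUpTo-within : ∀ f {m n} → m ℕ.≤′ n → sqrtUpTo f n m ≡ sqrt f m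
  sqrtUpTo-within f ℕ.≤′-refl       = refl
  sqrtUpTo-within f (ℕ.≤′-step m≤n) =
    trans (sqrtUpTo-old f (ℕ.<⇒≢ (s≤s (ℕ.≤′⇒≤ m≤n)))) (sqrtUpTo-within f m≤n)

  -- The coefficient of xⁿ⁺¹ in a square, with the two extreme terms split off.

  inner : PowerSeries → ℕ → ℚ
  inner f n = ∑[ i < n ] (f (suc (toℕ i)) * f (n ∸ toℕ i))

  square-suc : ∀ f n → (f *ˢ f) (suc n) ≡ f 0 * f (suc n) + (inner f n + f (suc n) * f 0)
  square-suc f n = cong ((f 0 * f (suc n)) +_) (trans
    (sum-init-last (λ (i : Fin (suc n)) → f (suc (toℕ i)) * f (n ∸ toℕ i)))
    (cong₂ _+_
      (sum-cong-≗ {n} λ i → cong (λ j → f (suc j) * f (n ∸ j)) (toℕ-inject₁ i))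
      (trans (cong (λ j → f (suc j) * f (n ∸ j)) (toℕ-fromℕ n))
             (cong (λ j → f (suc n) * f j) (ℕ.n∸n≡0 n)))))

sqrt-square : ∀ f → f 0 ≡ 1ℚ → sqrt f *ˢ sqrt f ≗ f
sqrt-square f f₀≡1 zero    = sym f₀≡1
sqrt-square f f₀≡1 (suc n) = begin
  (S *ˢ S) (suc n)
    ≡⟨ square-suc S n ⟩
  1ℚ * S (suc n) + (inner S n + S (suc n) * 1ℚ)
    ≡⟨ cong (λ s → 1ℚ * s + (inner S n + s * 1ℚ)) (trans (sqrtUpTo-new f n) (cong (λ q → ½ * (f (suc n) - q)) old)) ⟩
  1ℚ * (½ * (f (suc n) - inner S n)) + (inner S n + ½ * (f (suc n) - inner S n) * 1ℚ)
    ≡⟨ solve 2 (λ a p → con 1ℚ :* (con ½ :* (a :- p)) :+ (p :+ con ½ :* (a :- p) :* con 1ℚ) := a) refl (f (suc n)) (inner S n) ⟩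
  f (suc n) ∎
  where
  open ≡-Reasoning
  open +-*-Solver
  S = sqrt f
  Sₙ = sqrtUpTo f n
  within : ∀ {m} → m ℕ.≤ n → Sₙ m ≡ S m
  within m≤n = sqrtUpTo-within f (ℕ.≤⇒≤′ m≤n)
  inner≡ : inner Sₙ n ≡ inner S n
  inner≡ = sum-cong-≗ {n} λ i → cong₂ _*_ (within (toℕ<n i)) (within (ℕ.m∸n≤m n (toℕ i)))
  old : (Sₙ *ˢ Sₙ) (suc n) ≡ inner S n
  old = begin
    (Sₙ *ˢ Sₙ) (suc n)
      ≡⟨ square-suc Sₙ n ⟩
    Sₙ 0 * Sₙ (suc n) + (inner Sₙ n + Sₙ (suc n) * Sₙ 0)
      ≡⟨ cong₂ (λ s p → Sₙ 0 * s + (p + s * Sₙ 0)) (sqrtUpTo-beyond f n (ℕ.n<1+n n)) inner≡ ⟩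
    Sₙ 0 * 0ℚ + (inner S n + 0ℚ * Sₙ 0)
      ≡⟨ solve 2 (λ a p → a :* con 0ℚ :+ (p :+ con 0ℚ :* a) := p) refl (Sₙ 0) (inner S n) ⟩
    inner S n ∎

-- Σ_{n≥1} aₙ xⁿ

genFun : (ℕ → ℕ) → PowerSeries
genFun a zero      = 0ℚ
genFun a n@(suc _) = fromℕ (a n)

B B* : ℕ → PowerSeries
B  k = genFun (λ n → b n k)
B* k = genFun (λ n → b* n k)

√[1-6x+x²] : PowerSeries
√[1-6x+x²] = sqrt (const 1 -ˢ const 6 *ˢ X +ˢ X *ˢ X)

{-# OPTIONS --safe #-}

-- Let T, F, R, V, Q be the generating functions, by number of leaves, of trees,
-- of lists of trees, of trees with balanced root of rank k, and of the balanced
-- vertices of rank k in trees and in lists of trees.  Splitting off the root or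
-- the first tree of a list gives
--   T = x + T²F,  F = 1 + TF,  Q = VF + TQ,  V = R + VTF + T(VF + TQ).
-- The first two say that (1 + x - 4T)² = 1 - 6x + x², so the square root S is
-- 1 + x - 4T, and then the other two give SV = (1 - T)R, where
-- 4(1 - T) = 3 - x + S.

module Submission where

open import Defs
open import Algebra.Bundles using (AbelianGroup; CommutativeRing)
import Algebra.Consequences.Setoid as Consequences
import Algebra.Construct.Pointwise as Pointwise
import Algebra.Solver.Ring as RingSolver
open import Algebra.Solver.Ring.AlmostCommutativeRing
  using (fromCommutativeRing; _-Raw-AlmostCommutative⟶_)
import Data.Integer.Base as ℤ
import Data.Integer.Properties as ℤ
open import Data.List.Base
  using (List; []; _∷_; [_]; _++_; map; concatMap; length; filter; cartesianProduct)
open import Data.List.Properties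
  using (concatMap-map; length-++; filter-++; cartesianProductWith-zeroʳ)
import Data.Maybe.Base as Maybe
open import Data.Nat.Base as ℕ using (ℕ; zero; suc; _≤_; z≤n; _≤′_; ≤′-refl; ≤′-step)
open import Data.Nat.ListAction using (sum)
import Data.Nat.Properties as ℕ
open import Data.Product.Base using (_×_; _,_; uncurry; map₁)
open import Data.Rational.Base using (ℚ; 0ℚ; 1ℚ; _+_; _*_; -_; NonZero; toℚᵘ)
import Data.Rational.Properties as ℚ
open import Data.Rational.Solver using (module +-*-Solver)
import Data.Rational.Unnormalised.Base as ℚᵘ
import Data.Rational.Unnormalised.Properties as ℚᵘ
open import Function.Base using (_∘_)
open import Level using (0ℓ)
open import Relation.Binary.PropositionalEquality
  using (_≡_; refl; sym; trans; cong; cong₂; _≗_; module ≡-Reasoning)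
open import Relation.Nullary.Decidable using (dec⇒maybe)

-- The ring of power series

tail : PowerSeries → PowerSeries
tail f n = f (suc n)

-ˢ_ : PowerSeries → PowerSeries
(-ˢ f) n = - f n

scale : ℚ → PowerSeries → PowerSeries
scale c f n = c * f n

-- Extends `const` to all rationals, which makes it the coefficient homomorphism of the ring solver
-- below.
scalar : ℚ → PowerSeries
scalar c zero    = c
scalar c (suc _) = 0ℚ

-- (f *ˢ g) (suc n) is definitionally f 0 * g (suc n) + (tail f *ˢ g) n, so the
-- ring laws are proved by induction on n with the left factor varying.

*ˢ-cong : ∀ {f f′ g g′} → f ≗ f′ → g ≗ g′ → f *ˢ g ≗ f′ *ˢ g′
*ˢ-cong p q zero    = cong (_+ 0ℚ) (cong₂ _*_ (p 0) (q 0))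
*ˢ-cong p q (suc n) =
  cong₂ _+_ (cong₂ _*_ (p 0) (q (suc n))) (*ˢ-cong (λ m → p (suc m)) q n)

*ˢ-distribʳ : ∀ h f g → (f +ˢ g) *ˢ h ≗ f *ˢ h +ˢ g *ˢ h
*ˢ-distribʳ h f g zero = solve 3
  (λ h f g → (f :+ g) :* h :+ con 0ℚ := (f :* h :+ con 0ℚ) :+ (g :* h :+ con 0ℚ)) refl (h 0) (f 0) (g 0)
  where open +-*-Solver
*ˢ-distribʳ h f g (suc n) = trans
  (cong ((f 0 + g 0) * h (suc n) +_) (*ˢ-distribʳ h (tail f) (tail g) n))
  (solve 5 (λ h f g a b → (f :+ g) :* h :+ (a :+ b) := (f :* h :+ a) :+ (g :* h :+ b)) refl
    (h (suc n)) (f 0) (g 0) _ _)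
  where open +-*-Solver

scale-*ˢ : ∀ c f g → scale c f *ˢ g ≗ scale c (f *ˢ g)
scale-*ˢ c f g zero = solve 3
  (λ c f g → (c :* f) :* g :+ con 0ℚ := c :* (f :* g :+ con 0ℚ)) refl c (f 0) (g 0)
  where open +-*-Solver
scale-*ˢ c f g (suc n) = trans
  (cong (c * f 0 * g (suc n) +_) (scale-*ˢ c (tail f) g n))
  (solve 4 (λ c f g a → (c :* f) :* g :+ c :* a := c :* (f :* g :+ a)) refl c (f 0) (g (suc n)) _)
  where open +-*-Solver

-- The mirror image of the definitional unfolding: the last term of the convolution is split off
-- instead of the first. Commutativity then follows by induction.
*ˢ-sucʳ : ∀ f g n → (f *ˢ g) (suc n) ≡ f (suc n) * g 0 + (f *ˢ tail g) n
*ˢ-sucʳ f g zero = solve 4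
  (λ f₀ f₁ g₀ g₁ → f₀ :* g₁ :+ (f₁ :* g₀ :+ con 0ℚ) := f₁ :* g₀ :+ (f₀ :* g₁ :+ con 0ℚ)) refl
  (f 0) (f 1) (g 0) (g 1)
  where open +-*-Solver
*ˢ-sucʳ f g (suc n) = trans
  (cong (f 0 * g (suc (suc n)) +_) (*ˢ-sucʳ (tail f) g n))
  (solve 3 (λ a b c → a :+ (b :+ c) := b :+ (a :+ c)) refl
    (f 0 * g (suc (suc n))) (f (suc (suc n)) * g 0) _)
  where open +-*-Solver

*ˢ-comm : ∀ f g → f *ˢ g ≗ g *ˢ f
*ˢ-comm f g zero    = cong (_+ 0ℚ) (ℚ.*-comm (f 0) (g 0))
*ˢ-comm f g (suc n) = trans
  (cong₂ _+_ (ℚ.*-comm (f 0) (g (suc n))) (*ˢ-comm (tail f) g n))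
  (sym (*ˢ-sucʳ g f n))

*ˢ-assoc : ∀ f g h → (f *ˢ g) *ˢ h ≗ f *ˢ (g *ˢ h)
*ˢ-assoc f g h zero = solve 3
  (λ f g h → (f :* g :+ con 0ℚ) :* h :+ con 0ℚ := f :* (g :* h :+ con 0ℚ) :+ con 0ℚ) refl
  (f 0) (g 0) (h 0)
  where open +-*-Solver
*ˢ-assoc f g h (suc n) = begin
  -- The tail of `f *ˢ g` unfolds to `scale (f 0) (tail g) +ˢ tail f *ˢ g`.
  (f 0 * g 0 + 0ℚ) * h (suc n) + ((scale (f 0) (tail g) +ˢ tail f *ˢ g) *ˢ h) n
    ≡⟨ cong ((f 0 * g 0 + 0ℚ) * h (suc n) +_) (trans
         (*ˢ-distribʳ h (scale (f 0) (tail g)) (tail f *ˢ g) n)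
         (cong₂ _+_ (scale-*ˢ (f 0) (tail g) h n) (*ˢ-assoc (tail f) g h n))) ⟩
  (f 0 * g 0 + 0ℚ) * h (suc n) + (f 0 * (tail g *ˢ h) n + (tail f *ˢ (g *ˢ h)) n)
    ≡⟨ solve 5 (λ f g h a b → (f :* g :+ con 0ℚ) :* h :+ (f :* a :+ b) := f :* (g :* h :+ a) :+ b) refl
         (f 0) (g 0) (h (suc n)) _ _ ⟩
  f 0 * (g 0 * h (suc n) + (tail g *ˢ h) n) + (tail f *ˢ (g *ˢ h)) n ∎
  where
  open ≡-Reasoning
  open +-*-Solver

0-*ˢ : ∀ f → (λ _ → 0ℚ) *ˢ f ≗ λ _ → 0ℚ
0-*ˢ f zero    = solve 1 (λ f → con 0ℚ :* f :+ con 0ℚ := con 0ℚ) refl (f 0)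
  where open +-*-Solver
0-*ˢ f (suc n) = trans (cong (0ℚ * f (suc n) +_) (0-*ˢ f n))
  (solve 1 (λ f → con 0ℚ :* f :+ con 0ℚ := con 0ℚ) refl (f (suc n)))
  where open +-*-Solver

scalar-*ˢ : ∀ c f → scalar c *ˢ f ≗ scale c f
scalar-*ˢ c f zero    = ℚ.+-identityʳ (c * f 0)
scalar-*ˢ c f (suc n) = trans (cong (c * f (suc n) +_) (0-*ˢ f n)) (ℚ.+-identityʳ (c * f (suc n)))

const≗scalar : ∀ c → const c ≗ scalar (fromℕ c)
const≗scalar c zero    = refl
const≗scalar c (suc n) = refl

*ˢ-identityˡ : ∀ f → scalar 1ℚ *ˢ f ≗ f
*ˢ-identityˡ f n = trans (scalar-*ˢ 1ℚ f n) (ℚ.*-identityˡ (f n))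

+ˢ-abelianGroup : AbelianGroup 0ℓ 0ℓ
+ˢ-abelianGroup = Pointwise.abelianGroup ℕ ℚ.+-0-abelianGroup

powerSeriesRing : CommutativeRing 0ℓ 0ℓ
powerSeriesRing = record
  { Carrier = PowerSeries
  ; _≈_ = _≗_
  ; _+_ = _+ˢ_
  ; _*_ = _*ˢ_
  ; -_  = -ˢ_
  ; 0#  = λ _ → 0ℚ
  ; 1#  = scalar 1ℚ
  ; isCommutativeRing = record
    { isRing = record
      { +-isAbelianGroup = isAbelianGroup
      ; *-cong     = *ˢ-cong
      ; *-assoc    = *ˢ-assoc
      ; *-identity = comm∧idˡ⇒id *ˢ-comm *ˢ-identityˡ
      ; distrib    = comm∧distrʳ⇒distr ∙-cong *ˢ-comm *ˢ-distribʳ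
      }
    ; *-comm = *ˢ-comm
    }
  }
  where
  open AbelianGroup +ˢ-abelianGroup using (isAbelianGroup; setoid; ∙-cong)
  open Consequences setoid

scalar-homomorphism : CommutativeRing.rawRing ℚ.+-*-commutativeRing
  -Raw-AlmostCommutative⟶ fromCommutativeRing powerSeriesRing
scalar-homomorphism = record
  { ⟦_⟧    = scalar
  ; +-homo = λ { c d zero → refl ; c d (suc n) → refl }
  ; *-homo = λ { c d zero    → sym (scalar-*ˢ c (scalar d) zero)
               ; c d (suc n) → sym (trans (scalar-*ˢ c (scalar d) (suc n)) (ℚ.*-zeroʳ c)) }
  ; -‿homo = λ { c zero → refl ; c (suc n) → refl }
  ; 0-homo = λ { zero → refl ; (suc n) → refl }
  ; 1-homo = λ _ → refl
  }

-- Coefficients live in ℚ, whose equality is decidable, so the solver can compute with numerals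
-- although equality of series is undecidable.
module SeriesSolver = RingSolver
  (CommutativeRing.rawRing ℚ.+-*-commutativeRing) (fromCommutativeRing powerSeriesRing)
  scalar-homomorphism
  (λ c d → Maybe.map (λ c≡d n → cong (λ e → scalar e n) c≡d) (dec⇒maybe (c ℚ.≟ d)))

-- Lets a ring identity modulo hypotheses lᵢ ≗ rᵢ be checked by the solver in
-- the form s ≗ t + Σ cᵢ (lᵢ - rᵢ).

+-multiple : ∀ f c {l r} → l ≗ r → f +ˢ c *ˢ (l -ˢ r) ≗ f
+-multiple f c {l} {r} l≗r n = begin
  f n + (c *ˢ (l -ˢ r)) n        ≡⟨ cong (f n +_) (*ˢ-cong {c} (λ _ → refl) l-r≗0 n) ⟩
  f n + (c *ˢ (λ _ → 0ℚ)) n      ≡⟨ cong (f n +_) (trans (*ˢ-comm c (λ _ → 0ℚ) n) (0-*ˢ c n)) ⟩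
  f n + 0ℚ                       ≡⟨ ℚ.+-identityʳ (f n) ⟩
  f n                            ∎
  where
  open ≡-Reasoning
  l-r≗0 : l -ˢ r ≗ λ _ → 0ℚ
  l-r≗0 m = trans (cong (λ q → l m + - q) (sym (l≗r m))) (ℚ.+-inverseʳ (l m))

-- A nonzero constant term makes `g` a unit, with inverse `i` obtained by long division.
*ˢ-cancelʳ : ∀ {f h} g .{{_ : NonZero (g 0)}} → f *ˢ g ≗ h *ˢ g → f ≗ h
*ˢ-cancelʳ {f} {h} g fg≗hg n = begin
  f n
    ≡⟨ solve 4 (λ f g h i → f := h :+ i :* (f :* g :- h :* g) :+ (h :- f) :* (i :* g :- con 1ℚ))
         (λ _ → refl) f g h i n ⟩
  (h +ˢ i *ˢ (f *ˢ g -ˢ h *ˢ g) +ˢ (h -ˢ f) *ˢ (i *ˢ g -ˢ scalar 1ℚ)) n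
    ≡⟨ +-multiple (h +ˢ i *ˢ (f *ˢ g -ˢ h *ˢ g)) (h -ˢ f) (÷ˢ-*ˢ (scalar 1ℚ) g) n ⟩
  (h +ˢ i *ˢ (f *ˢ g -ˢ h *ˢ g)) n
    ≡⟨ +-multiple h i fg≗hg n ⟩
  h n ∎
  where
  open ≡-Reasoning
  open SeriesSolver
  i = scalar 1ℚ ÷ˢ g

-- Stability of the height-bounded enumeration

concatMap-splits-cong : ∀ {A : Set} n {f g : ℕ × ℕ → List A} →
  (∀ i j → i ℕ.+ j ≡ n → f (i , j) ≡ g (i , j)) →
  concatMap f (splits n) ≡ concatMap g (splits n)
concatMap-splits-cong zero            f≡g = cong (_++ []) (f≡g 0 0 refl)
concatMap-splits-cong (suc n) {f} {g} f≡g = cong₂ _++_ (f≡g 0 (suc n) refl) (begin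
  concatMap f (map (map₁ suc) (splits n))  ≡⟨ concatMap-map f (map₁ suc) (splits n) ⟩
  concatMap (f ∘ map₁ suc) (splits n)
    ≡⟨ concatMap-splits-cong n (λ i j p → f≡g (suc i) j (cong suc p)) ⟩
  concatMap (g ∘ map₁ suc) (splits n)      ≡⟨ concatMap-map g (map₁ suc) (splits n) ⟨
  concatMap g (map (map₁ suc) (splits n))  ∎)
  where open ≡-Reasoning

⊠-zero : ∀ {A B : Set} (as : ℕ → List A) (bs : ℕ → List B) → as 0 ≡ [] → (as ⊠ bs) 0 ≡ []
⊠-zero as bs as₀≡[] rewrite as₀≡[] = refl

cartesianProduct-[]ʳ : ∀ {A B : Set} (xs : List A) {ys : List B} → ys ≡ [] →
                       cartesianProduct xs ys ≡ []
cartesianProduct-[]ʳ xs refl = cartesianProductWith-zeroʳ _,_ xs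

-- Every tree uses up at least one leaf, so a list with `n` leaves in total never reaches a length
-- above `n`.
forests-suc : ∀ {ts} → ts 0 ≡ [] → ∀ m n → n ≤ m → forests ts (suc m) n ≡ forests ts m n
forests-suc {ts} ts₀≡[] zero zero z≤n =
  cong (λ us → nil 0 ++ map (uncurry _∷_) us) (⊠-zero ts (forests ts 0) ts₀≡[])
forests-suc {ts} ts₀≡[] (suc m) n n≤m =
  cong (λ us → nil n ++ map (uncurry _∷_) us) (concatMap-splits-cong n step)
  where
  step : ∀ i j → i ℕ.+ j ≡ n →
    cartesianProduct (ts i) (forests ts (suc m) j) ≡ cartesianProduct (ts i) (forests ts m j)
  step zero    j _ rewrite ts₀≡[] = refl
  step (suc i) j refl = cong (cartesianProduct (ts (suc i)))
    (forests-suc ts₀≡[] m j (ℕ.≤-trans (ℕ.m≤n+m j i) (ℕ.s≤s⁻¹ n≤m)))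

forests-bound : ∀ {ts} → ts 0 ≡ [] → ∀ {m n} → n ≤′ m → forests ts m n ≡ forests ts n n
forests-bound ts₀≡[] ≤′-refl       = refl
forests-bound ts₀≡[] (≤′-step n≤m) =
  trans (forests-suc ts₀≡[] _ _ (ℕ.≤′⇒≤ n≤m)) (forests-bound ts₀≡[] n≤m)

forests-cong : ∀ {ts ts′} m n → (∀ i → i ≤ n → ts i ≡ ts′ i) →
               forests ts m n ≡ forests ts′ m n
forests-cong zero    n _     = refl
forests-cong (suc m) n ts≡ts′ = cong (λ us → nil n ++ map (uncurry _∷_) us) (concatMap-splits-cong n λ
  { i j refl → cong₂ cartesianProduct (ts≡ts′ i (ℕ.m≤m+n i j))
      (forests-cong m j λ l l≤j → ts≡ts′ l (ℕ.≤-trans l≤j (ℕ.m≤n+m j i))) })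

-- Without trees on 0 leaves, every child of a node has fewer leaves than the node.

grow-cong : ∀ {ts ts′} n → ts 0 ≡ [] → ts′ 0 ≡ [] → (∀ i → i ≤ n → ts i ≡ ts′ i) →
            ∀ m → m ≤ suc n → grow ts m ≡ grow ts′ m
grow-cong {ts} {ts′} n ts₀≡[] ts′₀≡[] ts≡ts′ m m≤1+n =
  cong (λ us → single m ++ map mk us) (concatMap-splits-cong m step)
  where
  fs fs′ : ℕ → List (List Tree)
  fs  q = forests ts  q q
  fs′ q = forests ts′ q q
  step : ∀ i j → i ℕ.+ j ≡ m →
    cartesianProduct (ts i) ((ts ⊠ fs) j) ≡ cartesianProduct (ts′ i) ((ts′ ⊠ fs′) j)
  step zero j _ rewrite ts₀≡[] | ts′₀≡[] = refl
  -- Here `suc i` can be `suc n`, where agreement of `ts` and `ts′` is not assumed; both products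
  -- are empty because no second child has 0 leaves.
  step (suc i) zero _ = trans
    (cartesianProduct-[]ʳ (ts (suc i)) (⊠-zero ts fs ts₀≡[]))
    (sym (cartesianProduct-[]ʳ (ts′ (suc i)) (⊠-zero ts′ fs′ ts′₀≡[])))
  step (suc i) (suc j) refl = cong₂ cartesianProduct (ts≡ts′ (suc i) 1+i≤n) (concatMap-splits-cong (suc j) λ
    { p q p+q≡1+j → cong₂ cartesianProduct
        (ts≡ts′ p (ℕ.≤-trans (ℕ.≤-trans (ℕ.m≤m+n p q) (ℕ.≤-reflexive p+q≡1+j)) 1+j≤n))
        (forests-cong q q λ l l≤q → ts≡ts′ l
          (ℕ.≤-trans l≤q (ℕ.≤-trans (ℕ.≤-trans (ℕ.m≤n+m q p) (ℕ.≤-reflexive p+q≡1+j)) 1+j≤n))) })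
    where
    i+1+j≤n : i ℕ.+ suc j ≤ n
    i+1+j≤n = ℕ.s≤s⁻¹ m≤1+n
    1+j≤n : suc j ≤ n
    1+j≤n = ℕ.≤-trans (ℕ.m≤n+m (suc j) i) i+1+j≤n
    1+i≤n : suc i ≤ n
    1+i≤n = ℕ.≤-trans (ℕ.m≤m+n (suc i) j) (ℕ.≤-trans (ℕ.≤-reflexive (sym (ℕ.+-suc i j))) i+1+j≤n)

treesBelow-zero : ∀ h → treesBelow h 0 ≡ []
treesBelow-zero zero    = refl
treesBelow-zero (suc h) = cong (map mk)
  (⊠-zero (treesBelow h) (treesBelow h ⊠ λ q → forests (treesBelow h) q q) (treesBelow-zero h))

-- Each application of `grow` extends the range of agreement by one leaf.
treesBelow-suc : ∀ h n → n ≤ h → treesBelow (suc h) n ≡ treesBelow h n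
treesBelow-suc zero    zero z≤n = refl
treesBelow-suc (suc h) n    n≤h =
  grow-cong h (treesBelow-zero (suc h)) (treesBelow-zero h) (treesBelow-suc h) n n≤h

treesBelow-bound : ∀ {h n} → n ≤′ h → treesBelow h n ≡ trees n
treesBelow-bound ≤′-refl       = refl
treesBelow-bound (≤′-step n≤h) =
  trans (treesBelow-suc _ _ (ℕ.≤′⇒≤ n≤h)) (treesBelow-bound n≤h)

forest : ℕ → List (List Tree)
forest n = forests trees n n

-- The height bound in `trees` varies with the number of leaves. Stability removes it and makes
-- `trees` a fixed point of `grow`, from which the equations for T and V are read off.
trees-unfold : ∀ n → trees n ≡ grow trees n
trees-unfold zero    = refl
trees-unfold (suc n) = grow-cong n (treesBelow-zero n) refl
  (λ i i≤n → treesBelow-bound (ℕ.≤⇒≤′ i≤n)) (suc n) ℕ.≤-refl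

forest-unfold : ∀ n → forest n ≡ nil n ++ map (uncurry _∷_) ((trees ⊠ forest) n)
-- The length bound is raised to `suc n` so that `forests` unfolds; afterwards it is lowered to the
-- size of the remaining list.
forest-unfold n = trans (sym (forests-suc {trees} refl n n ℕ.≤-refl))
  (cong (λ us → nil n ++ map (uncurry _∷_) us) (concatMap-splits-cong n λ
    { i j refl → cong (cartesianProduct (trees i)) (forests-bound {trees} refl (ℕ.≤⇒≤′ (ℕ.m≤n+m j i))) }))

-- Weighted generating functions

total : {A : Set} → (A → ℚ) → List A → ℚ
total w []       = 0ℚ
total w (x ∷ xs) = w x + total w xs

module _ {A : Set} where

  total-++ : ∀ (w : A → ℚ) xs ys → total w (xs ++ ys) ≡ total w xs + total w ys
  total-++ w []       ys = sym (ℚ.+-identityˡ _)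
  total-++ w (x ∷ xs) ys = trans (cong (w x +_) (total-++ w xs ys)) (sym (ℚ.+-assoc (w x) _ _))

  total-cong : ∀ {v w : A → ℚ} → v ≗ w → total v ≗ total w
  total-cong v≗w []       = refl
  total-cong v≗w (x ∷ xs) = cong₂ _+_ (v≗w x) (total-cong v≗w xs)

  total-+ : ∀ (v w : A → ℚ) xs → total (λ x → v x + w x) xs ≡ total v xs + total w xs
  total-+ v w []       = refl
  total-+ v w (x ∷ xs) = trans (cong (v x + w x +_) (total-+ v w xs))
    (solve 4 (λ a b c d → a :+ b :+ (c :+ d) := a :+ c :+ (b :+ d)) refl (v x) (w x) _ _)
    where open +-*-Solver

  total-*ˡ : ∀ c (w : A → ℚ) xs → total (λ x → c * w x) xs ≡ c * total w xs
  total-*ˡ c w []       = sym (ℚ.*-zeroʳ c)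
  total-*ˡ c w (x ∷ xs) = trans (cong (c * w x +_) (total-*ˡ c w xs)) (sym (ℚ.*-distribˡ-+ c _ _))

total-map : ∀ {A B : Set} (w : B → ℚ) (f : A → B) xs → total w (map f xs) ≡ total (w ∘ f) xs
total-map w f []       = refl
total-map w f (x ∷ xs) = cong (w (f x) +_) (total-map w f xs)

infixr 7 _⊗_

_⊗_ : {A B : Set} → (A → ℚ) → (B → ℚ) → A × B → ℚ
(v ⊗ w) (x , y) = v x * w y

total-cartesianProduct : ∀ {A B : Set} (v : A → ℚ) (w : B → ℚ) xs ys →
  total (v ⊗ w) (cartesianProduct xs ys) ≡ total v xs * total w ys
total-cartesianProduct v w []       ys = sym (ℚ.*-zeroˡ (total w ys))
total-cartesianProduct v w (x ∷ xs) ys = begin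
  total (v ⊗ w) (map (x ,_) ys ++ cartesianProduct xs ys)
    ≡⟨ total-++ (v ⊗ w) (map (x ,_) ys) _ ⟩
  total (v ⊗ w) (map (x ,_) ys) + total (v ⊗ w) (cartesianProduct xs ys)
    ≡⟨ cong₂ _+_ (trans (total-map (v ⊗ w) (x ,_) ys) (total-*ˡ (v x) w ys))
                 (total-cartesianProduct v w xs ys) ⟩
  v x * total w ys + total v xs * total w ys
    ≡⟨ ℚ.*-distribʳ-+ (total w ys) (v x) (total v xs) ⟨
  (v x + total v xs) * total w ys ∎
  where open ≡-Reasoning

series : {A : Set} → (A → ℚ) → (ℕ → List A) → PowerSeries
series w as n = total w (as n)

-- The recursion of `splits` matches that of `*ˢ`: shifting the first components is passing from
-- `as` to `as ∘ suc`, the tail of the left factor.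
series-⊠ : ∀ {A B : Set} (v : A → ℚ) (w : B → ℚ) as bs →
           series (v ⊗ w) (as ⊠ bs) ≗ series v as *ˢ series w bs
series-⊠ v w as bs zero = trans (total-++ (v ⊗ w) (cartesianProduct (as 0) (bs 0)) [])
  (cong (_+ 0ℚ) (total-cartesianProduct v w (as 0) (bs 0)))
series-⊠ v w as bs (suc n) = trans
  (total-++ (v ⊗ w) (cartesianProduct (as 0) (bs (suc n))) _)
  (cong₂ _+_ (total-cartesianProduct v w (as 0) (bs (suc n)))
    (trans (cong (total (v ⊗ w)) (concatMap-map _ (map₁ suc) (splits n)))
           (series-⊠ v w (as ∘ suc) bs n)))

-- The normalisation inside `fromℕ` does not reduce on variables, so the sum is compared on
-- unnormalised fractions with denominator 1.
fromℕ-+ : ∀ m n → fromℕ (m ℕ.+ n) ≡ fromℕ m + fromℕ n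
fromℕ-+ m n = ℚ.toℚᵘ-injective (begin-equality
  toℚᵘ (fromℕ (m ℕ.+ n))
    ≃⟨ ℚ.toℚᵘ-fromℚᵘ (integer (m ℕ.+ n)) ⟩
  integer (m ℕ.+ n)
    ≃⟨ ℚᵘ.*≡* (cong (ℤ._* ℤ.1ℤ)
         (sym (cong₂ ℤ._+_ (ℤ.*-identityʳ (ℤ.+ m)) (ℤ.*-identityʳ (ℤ.+ n))))) ⟩
  integer m ℚᵘ.+ integer n
    ≃⟨ ℚᵘ.+-cong (ℚ.toℚᵘ-fromℚᵘ (integer m)) (ℚ.toℚᵘ-fromℚᵘ (integer n)) ⟨
  toℚᵘ (fromℕ m) ℚᵘ.+ toℚᵘ (fromℕ n)
    ≃⟨ ℚ.toℚᵘ-homo-+ (fromℕ m) (fromℕ n) ⟨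
  toℚᵘ (fromℕ m + fromℕ n) ∎)
  where
  open ℚᵘ.≤-Reasoning
  integer : ℕ → ℚᵘ.ℚᵘ
  integer i = ℚᵘ.mkℚᵘ (ℤ.+ i) 0

fromℕ-sum : ∀ {A : Set} (f : A → ℕ) xs → fromℕ (sum (map f xs)) ≡ total (fromℕ ∘ f) xs
fromℕ-sum f []       = refl
fromℕ-sum f (x ∷ xs) = trans (fromℕ-+ (f x) (sum (map f xs))) (cong (fromℕ (f x) +_) (fromℕ-sum f xs))

one : {A : Set} → A → ℚ
one _ = 1ℚ

-- Functional equations for trees and lists of trees

T F : PowerSeries
T = series one trees
F = series one forest

T-equation : T ≗ X +ˢ T *ˢ (T *ˢ F)
T-equation n = begin
  T n
    ≡⟨ cong (total one) (trees-unfold n) ⟩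
  total one (grow trees n)
    ≡⟨ total-++ one (single n) _ ⟩
  total one (single n) + total one (map mk ((trees ⊠ trees ⊠ forest) n))
    ≡⟨ cong₂ _+_ (single-total n) (trans (total-map one mk ((trees ⊠ trees ⊠ forest) n))
         (series-⊠ one (one ⊗ one) trees (trees ⊠ forest) n)) ⟩
  X n + (T *ˢ series (one ⊗ one) (trees ⊠ forest)) n
    ≡⟨ cong (X n +_) (*ˢ-cong {T} (λ _ → refl) (series-⊠ one one trees forest) n) ⟩
  X n + (T *ˢ (T *ˢ F)) n ∎
  where
  open ≡-Reasoning
  single-total : ∀ n → total one (single n) ≡ X n
  single-total 0             = refl
  single-total 1             = refl
  single-total (suc (suc n)) = refl

F-equation : F ≗ scalar 1ℚ +ˢ T *ˢ F
F-equation n = begin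
  F n
    ≡⟨ cong (total one) (forest-unfold n) ⟩
  total one (nil n ++ map (uncurry _∷_) ((trees ⊠ forest) n))
    ≡⟨ total-++ one (nil n) _ ⟩
  total one (nil n) + total one (map (uncurry _∷_) ((trees ⊠ forest) n))
    ≡⟨ cong₂ _+_ (nil-total n) (trans (total-map one (uncurry _∷_) ((trees ⊠ forest) n))
         (series-⊠ one one trees forest n)) ⟩
  scalar 1ℚ n + (T *ˢ F) n ∎
  where
  open ≡-Reasoning
  nil-total : ∀ n → total one (nil n) ≡ scalar 1ℚ n
  nil-total zero    = refl
  nil-total (suc n) = refl

-- Identification of the square root

S W : PowerSeries
S = √[1-6x+x²]
W = scalar 1ℚ +ˢ X -ˢ scalar (fromℕ 4) *ˢ T

-- The radicand written with `scalar` in place of `const`, the form the solver works with.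
discriminant : PowerSeries
discriminant = scalar 1ℚ -ˢ scalar (fromℕ 6) *ˢ X +ˢ X *ˢ X

-- Eliminating F gives 2T² - (1 + x)T + x = 0. Completing the square turns this into (1 + x - 4T)² =
-- (1 + x)² - 8x.
W-square : W *ˢ W ≗ discriminant
W-square n = begin
  (W *ˢ W) n
    -- The equation for T is multiplied by T - 1 and the one for F by -T², which cancels F; the
    -- factor 8 comes from completing the square.
    ≡⟨ solve 3 (λ X T F →
         (con 1ℚ :+ X :- con (fromℕ 4) :* T) :* (con 1ℚ :+ X :- con (fromℕ 4) :* T) :=
         con 1ℚ :- con (fromℕ 6) :* X :+ X :* X
           :+ con (fromℕ 8) :* (T :- con 1ℚ) :* (T :- (X :+ T :* (T :* F)))
           :+ con (- fromℕ 8) :* T :* T :* (F :- (con 1ℚ :+ T :* F)))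
         (λ _ → refl) X T F n ⟩
  (discriminant +ˢ c₁ *ˢ e₁ +ˢ c₂ *ˢ e₂) n
    ≡⟨ +-multiple (discriminant +ˢ c₁ *ˢ e₁) c₂ F-equation n ⟩
  (discriminant +ˢ c₁ *ˢ e₁) n
    ≡⟨ +-multiple discriminant c₁ T-equation n ⟩
  discriminant n ∎
  where
  open ≡-Reasoning
  open SeriesSolver
  c₁ c₂ e₁ e₂ : PowerSeries
  c₁ = scalar (fromℕ 8) *ˢ (T -ˢ scalar 1ℚ)
  c₂ = scalar (- fromℕ 8) *ˢ T *ˢ T
  e₁ = T -ˢ (X +ˢ T *ˢ (T *ˢ F))
  e₂ = F -ˢ (scalar 1ℚ +ˢ T *ˢ F)

S-square : S *ˢ S ≗ discriminant
S-square n = trans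
  (sqrt-square (const 1 -ˢ const 6 *ˢ X +ˢ X *ˢ X) refl n)
  (cong (_+ (X *ˢ X) n) (cong₂ (λ p q → p + - q)
    (const≗scalar 1 n) (*ˢ-cong {g = X} (const≗scalar 6) (λ _ → refl) n)))

-- S² = W², and S + W is cancellable because its constant term is 2.

S≗W : S ≗ W
S≗W = *ˢ-cancelʳ (S +ˢ W) λ n → begin
  (S *ˢ (S +ˢ W)) n
    ≡⟨ solve 3 (λ S W D → S :* (S :+ W) :=
         W :* (S :+ W) :+ con 1ℚ :* (S :* S :- D) :+ con (- 1ℚ) :* (W :* W :- D))
         (λ _ → refl) S W discriminant n ⟩
  (W *ˢ (S +ˢ W) +ˢ scalar 1ℚ *ˢ (S *ˢ S -ˢ discriminant)
    +ˢ scalar (- 1ℚ) *ˢ (W *ˢ W -ˢ discriminant)) n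
    ≡⟨ +-multiple (W *ˢ (S +ˢ W) +ˢ scalar 1ℚ *ˢ (S *ˢ S -ˢ discriminant))
         (scalar (- 1ℚ)) W-square n ⟩
  (W *ˢ (S +ˢ W) +ˢ scalar 1ℚ *ˢ (S *ˢ S -ˢ discriminant)) n
    ≡⟨ +-multiple (W *ˢ (S +ˢ W)) (scalar 1ℚ) S-square n ⟩
  (W *ˢ (S +ˢ W)) n ∎
  where
  open ≡-Reasoning
  open SeriesSolver

-- Functional equations for balanced vertices

module _ (k : ℕ) where

  # : List Tree → ℚ
  # ts = fromℕ (length (filter (balancedOfRank? k) ts))

  #-++ : ∀ ts us → # (ts ++ us) ≡ # ts + # us
  #-++ ts us = trans
    (cong fromℕ (trans (cong length (filter-++ P? ts us)) (length-++ (filter P? ts))))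
    (fromℕ-+ (length (filter P? ts)) (length (filter P? us)))
    where P? = balancedOfRank? k

  #≡total : ∀ ts → # ts ≡ total (λ t → # [ t ]) ts
  #≡total []       = refl
  #≡total (t ∷ ts) = trans (#-++ [ t ] ts) (cong (# [ t ] +_) (#≡total ts))

  r v : Tree → ℚ
  r t = # [ t ]
  v t = # (vertices t)

  vᶠ : List Tree → ℚ
  vᶠ ts = # (verticesᶠ ts)

  R V Q : PowerSeries
  R = series r trees
  V = series v trees
  Q = series vᶠ forest

  B≗V : B k ≗ V
  -- `genFun` has constant term 0 by definition, and `trees 0` is empty.
  B≗V zero    = refl
  B≗V (suc n) = fromℕ-sum (λ t → length (filter (balancedOfRank? k) (vertices t))) (trees (suc n))

  B*≗R : B* k ≗ R
  B*≗R zero    = refl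
  B*≗R (suc n) = #≡total (trees (suc n))

  -- A product rule: the counted vertex lies either in the first tree or in the rest of the list,
  -- and the other component is counted with weight 1.
  pair-series : series (λ p → (v ⊗ one) p + (one ⊗ vᶠ) p) (trees ⊠ forest) ≗ V *ˢ F +ˢ T *ˢ Q
  pair-series n = trans (total-+ (v ⊗ one) (one ⊗ vᶠ) ((trees ⊠ forest) n))
    (cong₂ _+_ (series-⊠ v one trees forest n) (series-⊠ one vᶠ trees forest n))

  pair-weight : ∀ t ts → # (vertices t ++ verticesᶠ ts) ≡ v t * 1ℚ + 1ℚ * vᶠ ts
  pair-weight t ts = trans (#-++ (vertices t) (verticesᶠ ts))
    (sym (cong₂ _+_ (ℚ.*-identityʳ (v t)) (ℚ.*-identityˡ (vᶠ ts))))

  Q-equation : Q ≗ V *ˢ F +ˢ T *ˢ Q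
  Q-equation n = begin
    Q n
      ≡⟨ cong (total vᶠ) (forest-unfold n) ⟩
    total vᶠ (nil n ++ map (uncurry _∷_) ((trees ⊠ forest) n))
      ≡⟨ total-++ vᶠ (nil n) _ ⟩
    total vᶠ (nil n) + total vᶠ (map (uncurry _∷_) ((trees ⊠ forest) n))
      ≡⟨ cong₂ _+_ (nil-total n) (trans (total-map vᶠ (uncurry _∷_) ((trees ⊠ forest) n))
           (total-cong (uncurry pair-weight) ((trees ⊠ forest) n))) ⟩
    0ℚ + total (λ p → (v ⊗ one) p + (one ⊗ vᶠ) p) ((trees ⊠ forest) n)
      ≡⟨ trans (ℚ.+-identityˡ _) (pair-series n) ⟩
    (V *ˢ F +ˢ T *ˢ Q) n ∎
    where
    open ≡-Reasoning
    nil-total : ∀ n → total vᶠ (nil n) ≡ 0ℚ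
    nil-total zero    = refl
    nil-total (suc n) = refl

  V-equation : V ≗ R +ˢ (V *ˢ (T *ˢ F) +ˢ T *ˢ (V *ˢ F +ˢ T *ˢ Q))
  V-equation n = begin
    V n
      ≡⟨ cong (total v) (trees-unfold n) ⟩
    total v (grow trees n)
      ≡⟨ total-++ v (single n) _ ⟩
    total v (single n) + total v (map mk triples)
      ≡⟨ cong₂ _+_ (single-total n) (trans (total-map v mk triples)
           (trans (total-cong node-weight triples) (total-+ (r ∘ mk) below triples))) ⟩
    -- The only vertex of the leaf is its root, so `v` may be replaced by `r` on `single n`. The
    -- leaf then joins the roots of the nodes to form `R n`.
    total r (single n) + (total (r ∘ mk) triples + total below triples)
      ≡⟨ ℚ.+-assoc (total r (single n)) _ _ ⟨
    total r (single n) + total (r ∘ mk) triples + total below triples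
      ≡⟨ cong₂ _+_ roots below-total ⟩
    R n + (V *ˢ (T *ˢ F) +ˢ T *ˢ (V *ˢ F +ˢ T *ˢ Q)) n ∎
    where
    open ≡-Reasoning
    triples : List (Tree × Tree × List Tree)
    triples = (trees ⊠ trees ⊠ forest) n
    pair-below : Tree × List Tree → ℚ
    pair-below p = (v ⊗ one) p + (one ⊗ vᶠ) p
    below : Tree × Tree × List Tree → ℚ
    below p = (v ⊗ one ⊗ one) p + (one ⊗ pair-below) p
    single-total : ∀ n → total v (single n) ≡ total r (single n)
    single-total 0             = refl
    single-total 1             = refl
    single-total (suc (suc n)) = refl
    node-weight : ∀ p → v (mk p) ≡ r (mk p) + below p
    node-weight (t , u , us) = trans (#-++ [ mk (t , u , us) ] _) (cong (r (mk (t , u , us)) +_)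
      (trans (#-++ (vertices t) (vertices u ++ verticesᶠ us)) (cong₂ _+_
        (sym (ℚ.*-identityʳ (v t)))
        (trans (pair-weight u us) (sym (ℚ.*-identityˡ (pair-below (u , us))))))))
    roots : total r (single n) + total (r ∘ mk) triples ≡ R n
    roots = begin
      total r (single n) + total (r ∘ mk) triples     ≡⟨ cong (total r (single n) +_) (total-map r mk triples) ⟨
      total r (single n) + total r (map mk triples)   ≡⟨ total-++ r (single n) _ ⟨
      total r (grow trees n)                          ≡⟨ cong (total r) (trees-unfold n) ⟨
      R n                                             ∎
    below-total : total below triples ≡ (V *ˢ (T *ˢ F) +ˢ T *ˢ (V *ˢ F +ˢ T *ˢ Q)) n
    below-total = trans (total-+ (v ⊗ one ⊗ one) (one ⊗ pair-below) triples) (cong₂ _+_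
      (trans (series-⊠ v (one ⊗ one) trees (trees ⊠ forest) n)
             (*ˢ-cong {V} (λ _ → refl) (series-⊠ one one trees forest) n))
      (trans (series-⊠ one pair-below trees (trees ⊠ forest) n)
             (*ˢ-cong {T} (λ _ → refl) pair-series n)))


  -- In closed form F = 1/(1 - T) and Q = VF². The equation for V becomes V(2 - F²) = R, and (1 -
  -- T)(2 - F²) = W.
  WV≗[1-T]R : W *ˢ V ≗ (scalar 1ℚ -ˢ T) *ˢ R
  WV≗[1-T]R n = begin
    (W *ˢ V) n
      -- Multiplying the equation for V by 1 - T leaves (1 - T)T²Q, which `c₃` turns into T²VF. Then
      -- `c₂` replaces (1 - T)F by 1 in the term 2T(1 - T)FV, and `c₁` replaces T²F by T - x.
      ≡⟨ solve 6 (λ X T F R V Q →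
           (con 1ℚ :+ X :- con (fromℕ 4) :* T) :* V :=
           (con 1ℚ :- T) :* R
             :+ con (- 1ℚ) :* V :* (T :- (X :+ T :* (T :* F)))
             :+ con (fromℕ 2) :* V :* T :* (F :- (con 1ℚ :+ T :* F))
             :+ T :* T :* (Q :- (V :* F :+ T :* Q))
             :+ (con 1ℚ :- T) :* (V :- (R :+ (V :* (T :* F) :+ T :* (V :* F :+ T :* Q)))))
           (λ _ → refl) X T F R V Q n ⟩
    (G +ˢ c₁ *ˢ e₁ +ˢ c₂ *ˢ e₂ +ˢ c₃ *ˢ e₃ +ˢ c₄ *ˢ e₄) n
      ≡⟨ +-multiple (G +ˢ c₁ *ˢ e₁ +ˢ c₂ *ˢ e₂ +ˢ c₃ *ˢ e₃) c₄ V-equation n ⟩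
    (G +ˢ c₁ *ˢ e₁ +ˢ c₂ *ˢ e₂ +ˢ c₃ *ˢ e₃) n
      ≡⟨ +-multiple (G +ˢ c₁ *ˢ e₁ +ˢ c₂ *ˢ e₂) c₃ Q-equation n ⟩
    (G +ˢ c₁ *ˢ e₁ +ˢ c₂ *ˢ e₂) n
      ≡⟨ +-multiple (G +ˢ c₁ *ˢ e₁) c₂ F-equation n ⟩
    (G +ˢ c₁ *ˢ e₁) n
      ≡⟨ +-multiple G c₁ T-equation n ⟩
    G n ∎
    where
    open ≡-Reasoning
    open SeriesSolver
    G c₁ c₂ c₃ c₄ e₁ e₂ e₃ e₄ : PowerSeries
    G  = (scalar 1ℚ -ˢ T) *ˢ R
    c₁ = scalar (- 1ℚ) *ˢ V
    c₂ = scalar (fromℕ 2) *ˢ V *ˢ T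
    c₃ = T *ˢ T
    c₄ = scalar 1ℚ -ˢ T
    e₁ = T -ˢ (X +ˢ T *ˢ (T *ˢ F))
    e₂ = F -ˢ (scalar 1ℚ +ˢ T *ˢ F)
    e₃ = Q -ˢ (V *ˢ F +ˢ T *ˢ Q)
    e₄ = V -ˢ (R +ˢ (V *ˢ (T *ˢ F) +ˢ T *ˢ (V *ˢ F +ˢ T *ˢ Q)))

-- Solving for the generating function of balanced vertices

quotient : PowerSeries
quotient = (const 3 -ˢ X +ˢ S) ÷ˢ (const 4 *ˢ S)

quotient-equation : quotient *ˢ (scalar (fromℕ 4) *ˢ S) ≗ scalar (fromℕ 3) -ˢ X +ˢ S
quotient-equation n = begin
  (quotient *ˢ (scalar (fromℕ 4) *ˢ S)) n
    ≡⟨ *ˢ-cong {quotient} (λ _ → refl) (*ˢ-cong {g = S} (const≗scalar 4) (λ _ → refl)) n ⟨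
  (quotient *ˢ (const 4 *ˢ S)) n
    ≡⟨ ÷ˢ-*ˢ (const 3 -ˢ X +ˢ S) (const 4 *ˢ S) n ⟩
  const 3 n + - X n + S n
    ≡⟨ cong (λ c → c + - X n + S n) (const≗scalar 3 n) ⟩
  scalar (fromℕ 3) n + - X n + S n ∎
  where open ≡-Reasoning

-- After multiplication by 4S, which has constant term 4, the claim is 4SV = (3 - x + S)R; since S =
-- W, the right side is 4(1 - T)R.
V≗R-quotient : ∀ k → V k ≗ R k *ˢ quotient
V≗R-quotient k = *ˢ-cancelʳ (scalar (fromℕ 4) *ˢ S) λ n → begin
  (V k *ˢ (scalar (fromℕ 4) *ˢ S)) n
    -- The multiplier 4V - R of S - W records the two replacements of S by W: in 4SV and in (3 - x +
    -- S)R.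
    ≡⟨ solve 6 (λ X T S R V D →
         let W = con 1ℚ :+ X :- con (fromℕ 4) :* T in
         V :* (con (fromℕ 4) :* S) :=
         (R :* D) :* (con (fromℕ 4) :* S)
           :+ con (- 1ℚ) :* R :* (D :* (con (fromℕ 4) :* S) :- (con (fromℕ 3) :- X :+ S))
           :+ con (fromℕ 4) :* (W :* V :- (con 1ℚ :- T) :* R)
           :+ (con (fromℕ 4) :* V :- R) :* (S :- W))
         (λ _ → refl) X T S (R k) (V k) quotient n ⟩
  (G +ˢ c₁ *ˢ e₁ +ˢ c₂ *ˢ e₂ +ˢ c₃ *ˢ e₃) n
    ≡⟨ +-multiple (G +ˢ c₁ *ˢ e₁ +ˢ c₂ *ˢ e₂) c₃ S≗W n ⟩
  (G +ˢ c₁ *ˢ e₁ +ˢ c₂ *ˢ e₂) n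
    ≡⟨ +-multiple (G +ˢ c₁ *ˢ e₁) c₂ (WV≗[1-T]R k) n ⟩
  (G +ˢ c₁ *ˢ e₁) n
    ≡⟨ +-multiple G c₁ quotient-equation n ⟩
  G n ∎
  where
  open ≡-Reasoning
  open SeriesSolver
  G c₁ c₂ c₃ e₁ e₂ e₃ : PowerSeries
  G  = (R k *ˢ quotient) *ˢ (scalar (fromℕ 4) *ˢ S)
  c₁ = scalar (- 1ℚ) *ˢ R k
  c₂ = scalar (fromℕ 4)
  c₃ = scalar (fromℕ 4) *ˢ V k -ˢ R k
  e₁ = quotient *ˢ (scalar (fromℕ 4) *ˢ S) -ˢ (scalar (fromℕ 3) -ˢ X +ˢ S)
  e₂ = W *ˢ V k -ˢ (scalar 1ℚ -ˢ T) *ˢ R k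
  e₃ = S -ˢ W

theorem4p2 : (k : ℕ) → B k ≗ B* k *ˢ ((const 3 -ˢ X +ˢ √[1-6x+x²]) ÷ˢ (const 4 *ˢ √[1-6x+x²]))
theorem4p2 k n = begin
  B k n                    ≡⟨ B≗V k n ⟩
  V k n                    ≡⟨ V≗R-quotient k n ⟩
  (R k *ˢ quotient) n      ≡⟨ *ˢ-cong {g = quotient} (B*≗R k) (λ _ → refl) n ⟨
  (B* k *ˢ quotient) n     ∎
  where open ≡-Reasoning
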